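{- Every triangle-free graph $G$ with maximum degree $\Delta(G)\ge 1$ satisfies $$\operatorname{diam}(G)\le \Delta(G)+\lfloor \log_2 \Delta(G)\rfloor .$$
   Context: Graphs are finite and simple. For an oriented graph $\overrightarrow{G}$ and $X\subseteq V(\overrightarrow{G})$, the inversion of $X$ reverses every arc having both endpoints in $X$ (and no other arc). For a (labeled) graph $G$, the inversion distance between two orientations of $G$ is the minimum number of inversions transforming one into the other (equality as labeled oriented graphs), and the inversion diameter $\operatorname{diam}(G)$ is the maximum inversion distance over all pairs of orientations of $G$. $\Delta(G)$ denotes the maximum degree of $G$. -}

module Defs where

open import Data.Bool.Base using (Bool; true; false; T; not; if_then_else_; _∧_; _∨_)
open import Data.Bool.Properties using (∧-comm; ∨-comm; ∧-idem) renaming (_≟_ to _≟ᵇ_)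
open import Data.Fin.Base using (Fin)
open import Data.Fin.Properties using (_≟_; all?; <-cmp)
open import Data.Fin.Subset using (Subset; ∣_∣)
open import Data.List.Base as List using (List; []; _∷_; allFin; cartesianProduct; cartesianProductWith)
open import Data.List.Extrema.Nat using (max; argmax; f[xs]≤f[argmax])
open import Data.List.Membership.Propositional using (_∈_; lose)
open import Data.List.Membership.Propositional.Properties
  using (∈-map⁺; ∈-allFin; ∈-cartesianProduct⁺; ∈-cartesianProductWith⁺)
open import Data.List.Relation.Unary.All using (lookup)
open import Data.List.Relation.Unary.Any using (here; there; any?; satisfied)
open import Data.Nat.Base using (ℕ; zero; suc; _≤_; z≤n; s≤s)
open import Data.Nat.Properties using (≤-antisym)
open import Data.Product.Base using (∃; ∃₂; _×_; _,_; proj₁; proj₂)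
open import Data.Vec.Base as Vec using (Vec; []; _∷_; tabulate)
open import Data.Vec.Properties using (lookup∘tabulate)
open import Data.Empty using (⊥-elim)
open import Relation.Binary.Definitions using (tri<; tri≈; tri>)
open import Relation.Binary.PropositionalEquality
  using (_≡_; _≢_; refl; sym; trans; cong; cong₂; subst)
open import Relation.Nullary using (¬_; Dec; yes; no; does)
open import Relation.Nullary.Decidable using (map′)

record Graph (n : ℕ) : Set where
  field
    adj         : Fin n → Fin n → Bool
    symmetric   : ∀ u v → adj u v ≡ adj v u
    irreflexive : ∀ v → adj v v ≡ false

  Adj : Fin n → Fin n → Set
  Adj u v = T (adj u v)

  neighbours : Fin n → Subset n
  neighbours v = tabulate (adj v)

  degree : Fin n → ℕ
  degree v = ∣ neighbours v ∣

open Graph public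

TriangleFree : ∀ {n} → Graph n → Set
TriangleFree G = ∀ u v w → ¬ (Adj G u v × Adj G v w × Adj G u w)

-- The maximum degree; it is 0 for the graph without vertices.
Δ : ∀ {n} → Graph n → ℕ
Δ {n} G = max 0 (List.map (degree G) (allFin n))

record Orientation {n : ℕ} (G : Graph n) : Set where
  field
    arc        : Fin n → Fin n → Bool
    asymmetric : ∀ u v → arc u v ∧ arc v u ≡ false
    underlying : ∀ u v → arc u v ∨ arc v u ≡ adj G u v

open Orientation public

-- Equality as labelled oriented graphs, ignoring the proof fields.
infix 4 _≈_

_≈_ : ∀ {n} {G : Graph n} → Orientation G → Orientation G → Set
o ≈ p = ∀ u v → arc o u v ≡ arc p u v

bothIn : ∀ {n} → Subset n → Fin n → Fin n → Bool
bothIn X u v = Vec.lookup X u ∧ Vec.lookup X v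

invert : ∀ {n} {G : Graph n} → Subset n → Orientation G → Orientation G
arc (invert X o) u v = if bothIn X u v then arc o v u else arc o u v
asymmetric (invert X o) u v
  rewrite ∧-comm (Vec.lookup X v) (Vec.lookup X u) with bothIn X u v
... | true  = asymmetric o v u
... | false = asymmetric o u v
underlying (invert X o) u v
  rewrite ∧-comm (Vec.lookup X v) (Vec.lookup X u) with bothIn X u v
... | true  = trans (∨-comm (arc o v u) (arc o u v)) (underlying o u v)
... | false = underlying o u v

invertAll : ∀ {n k} {G : Graph n} → Vec (Subset n) k → Orientation G → Orientation G
invertAll []       o = o
invertAll (X ∷ Xs) o = invertAll Xs (invert X o)

TransformableIn : ∀ {n} {G : Graph n} → ℕ → Orientation G → Orientation G → Set
TransformableIn {n} k o p = ∃ λ (Xs : Vec (Subset n) k) → invertAll Xs o ≈ p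

IsLeast : (ℕ → Set) → ℕ → Set
IsLeast P m = P m × (∀ k → P k → m ≤ k)

IsInversionDistance : ∀ {n} {G : Graph n} → Orientation G → Orientation G → ℕ → Set
IsInversionDistance o p = IsLeast (λ k → TransformableIn k o p)

IsInversionDiameter : ∀ {n} → Graph n → ℕ → Set
IsInversionDiameter G D =
    (∃₂ λ (o p : Orientation G) → IsInversionDistance o p D)
  × (∀ (o p : Orientation G) d → IsInversionDistance o p d → d ≤ D)

------------------------------------------------------------------------
-- Any two orientations of a graph have an inversion distance: arcs can be
-- reversed one at a time. Only the specification is exposed (abstract).

private
  pair : ∀ {n} → Fin n → Fin n → Subset n
  pair u v = tabulate (λ x → does (x ≟ u) ∨ does (x ≟ v))

  module _ {n} {G : Graph n} where

    noLoop : (o : Orientation G) → ∀ v → arc o v v ≡ false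
    noLoop o v = trans (sym (∧-idem (arc o v v))) (asymmetric o v v)

    bool : ∀ {g} a b c d → a ∧ b ≡ false → c ∧ d ≡ false →
           a ∨ b ≡ g → c ∨ d ≡ g → a ≢ c → b ≡ c × a ≡ d
    bool true  true  _     _     () _  _    _  _
    bool true  false true  _     _  _  _    _  a≢c = ⊥-elim (a≢c refl)
    bool true  false false true  _  _  _    _  _   = refl , refl
    bool true  false false false _  _  refl () _
    bool false _     false _     _  _  _    _  a≢c = ⊥-elim (a≢c refl)
    bool false _     true  true  _  () _    _  _
    bool false true  true  false _  _  _    _  _   = refl , refl
    bool false false true  false _  _  refl () _

    swap : (o p : Orientation G) → ∀ u v → arc o u v ≢ arc p u v →
           arc o v u ≡ arc p u v × arc o u v ≡ arc p v u
    swap o p u v =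
      bool (arc o u v) (arc o v u) (arc p u v) (arc p v u)
        (asymmetric o u v) (asymmetric p u v) (underlying o u v) (underlying p u v)

    inPair : Fin n → Fin n → Fin n → Bool
    inPair u v x = does (x ≟ u) ∨ does (x ≟ v)

    invert-pair : (o : Orientation G) → ∀ u v x y → arc (invert (pair u v) o) x y ≡
      (if inPair u v x ∧ inPair u v y then arc o y x else arc o x y)
    invert-pair o u v x y = cong (if_then arc o y x else arc o x y)
      (cong₂ _∧_ (lookup∘tabulate _ x) (lookup∘tabulate _ y))

    loop : (o p : Orientation G) → ∀ v → arc o v v ≡ arc p v v
    loop o p v = trans (noLoop o v) (sym (noLoop p v))

    fixes : (o p : Orientation G) → ∀ u v → arc o u v ≢ arc p u v →
            arc (invert (pair u v) o) u v ≡ arc p u v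
    fixes o p u v o≢p = trans (invert-pair o u v u v) go
      where
      go : (if inPair u v u ∧ inPair u v v then arc o v u else arc o u v) ≡ arc p u v
      go with u ≟ u | v ≟ v | v ≟ u
      ... | no u≢u | _      | _     = ⊥-elim (u≢u refl)
      ... | yes _  | no v≢v | _     = ⊥-elim (v≢v refl)
      ... | yes _  | yes _  | yes _ = proj₁ (swap o p u v o≢p)
      ... | yes _  | yes _  | no _  = proj₁ (swap o p u v o≢p)

    preserves : (o p : Orientation G) → ∀ u v → arc o u v ≢ arc p u v →
                ∀ x y → arc o x y ≡ arc p x y → arc (invert (pair u v) o) x y ≡ arc p x y
    preserves o p u v o≢p x y eq = trans (invert-pair o u v x y) go
      where
      go : (if inPair u v x ∧ inPair u v y then arc o y x else arc o x y) ≡ arc p x y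
      go with x ≟ u | x ≟ v | y ≟ u | y ≟ v
      ... | no _     | no _     | _        | _        = eq
      ... | yes _    | _        | no _     | no _     = eq
      ... | no _     | yes _    | no _     | no _     = eq
      ... | yes refl | _        | yes refl | _        = loop o p x
      ... | yes refl | _        | no _     | yes refl = ⊥-elim (o≢p eq)
      ... | no _     | yes refl | yes refl | _        = proj₂ (swap o p u v o≢p)
      ... | no _     | yes refl | no _     | yes refl = loop o p x

    repair : (p : Orientation G) (es : List (Fin n × Fin n)) (o : Orientation G) →
             (∀ x y → arc o x y ≢ arc p x y → (x , y) ∈ es) →
             ∃ λ k → TransformableIn k o p
    repair p [] o cover = 0 , [] , agree
      where
      agree : o ≈ p
      agree x y with arc o x y ≟ᵇ arc p x y
      ... | yes eq = eq
      ... | no neq with () ← cover x y neq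
    repair p ((u , v) ∷ es) o cover with arc o u v ≟ᵇ arc p u v
    ... | yes eq = repair p es o cover′
      where
      cover′ : ∀ x y → arc o x y ≢ arc p x y → (x , y) ∈ es
      cover′ x y neq with cover x y neq
      ... | here refl = ⊥-elim (neq eq)
      ... | there m   = m
    ... | no neq =
      let k , Xs , eq = repair p es (invert (pair u v) o) cover′
      in suc k , pair u v ∷ Xs , eq
      where
      cover′ : ∀ x y → arc (invert (pair u v) o) x y ≢ arc p x y → (x , y) ∈ es
      cover′ x y neq′ with cover x y (λ eq → neq′ (preserves o p u v neq x y eq))
      ... | here refl = ⊥-elim (neq′ (fixes o p u v neq))
      ... | there m   = m

  vecs : ∀ {A : Set} → List A → ∀ k → List (Vec A k)
  vecs as zero    = [] ∷ []
  vecs as (suc k) = cartesianProductWith _∷_ as (vecs as k)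

  ∈-vecs : ∀ {A : Set} {as : List A} → (∀ a → a ∈ as) → ∀ {k} (xs : Vec A k) → xs ∈ vecs as k
  ∈-vecs all []       = here refl
  ∈-vecs all (x ∷ xs) = ∈-cartesianProductWith⁺ _∷_ (all x) (∈-vecs all xs)

  subsets : ∀ n → List (Subset n)
  subsets = vecs (true ∷ false ∷ [])

  ∈-subsets : ∀ {n} (X : Subset n) → X ∈ subsets n
  ∈-subsets = ∈-vecs λ { true → here refl ; false → there (here refl) }

  least : (P : ℕ → Set) → (∀ k → Dec (P k)) → ∀ k → P k → ∃ (IsLeast P)
  least P P? k Pk with P? 0
  ... | yes P0 = 0 , P0 , λ _ _ → z≤n
  least P P? zero    Pk | no ¬P0 = ⊥-elim (¬P0 Pk)
  least P P? (suc k) Pk | no ¬P0 with least (λ j → P (suc j)) (λ j → P? (suc j)) k Pk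
  ... | m , Pm , min = suc m , Pm ,
        λ { zero P0 → ⊥-elim (¬P0 P0) ; (suc j) Pj → s≤s (min j Pj) }

transformableIn? : ∀ {n} {G : Graph n} k (o p : Orientation G) → Dec (TransformableIn k o p)
transformableIn? {n} k o p =
  map′ satisfied (λ (Xs , eq) → lose (∈-vecs ∈-subsets Xs) eq)
    (any? (λ Xs → all? λ u → all? λ v → arc (invertAll Xs o) u v ≟ᵇ arc p u v)
          (vecs (subsets n) k))

abstract
  inversionDistance-exists : ∀ {n} {G : Graph n} (o p : Orientation G) →
                             ∃ (IsInversionDistance o p)
  inversionDistance-exists {n} o p =
    let k , t = repair p (cartesianProduct (allFin n) (allFin n)) o
                  λ x y _ → ∈-cartesianProduct⁺ (∈-allFin x) (∈-allFin y)
    in least _ (λ j → transformableIn? j o p) k t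

inversionDistance : ∀ {n} {G : Graph n} → Orientation G → Orientation G → ℕ
inversionDistance o p = proj₁ (inversionDistance-exists o p)

------------------------------------------------------------------------
-- The maximum of the distances exists: up to _≈_ there are finitely many
-- orientations, each determined by a Boolean matrix read above the diagonal.

private
  module _ {n} (G : Graph n) where

    direction : Vec (Subset n) n → Fin n → Fin n → Bool
    direction M u v with <-cmp u v
    ... | tri< _ _ _ = Vec.lookup (Vec.lookup M u) v
    ... | tri≈ _ _ _ = false
    ... | tri> _ _ _ = not (Vec.lookup (Vec.lookup M v) u)

    fromMatrix : Vec (Subset n) n → Orientation G
    arc (fromMatrix M) u v = adj G u v ∧ direction M u v
    asymmetric (fromMatrix M) u v
      rewrite symmetric G v u with adj G u v
    ... | false = refl
    ... | true with <-cmp u v | <-cmp v u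
    ...   | tri< u<v _ _  | tri< _ _ u≮v  = ⊥-elim (u≮v u<v)
    ...   | tri< _ u≢v _  | tri≈ _ v≡u _  = ⊥-elim (u≢v (sym v≡u))
    ...   | tri≈ _ _ _    | _             = refl
    ...   | tri> _ u≢v _  | tri≈ _ v≡u _  = ⊥-elim (u≢v (sym v≡u))
    ...   | tri> _ _ v<u  | tri> v≮u _ _  = ⊥-elim (v≮u v<u)
    ...   | tri< _ _ _    | tri> _ _ _ with Vec.lookup (Vec.lookup M u) v
    ...     | true  = refl
    ...     | false = refl
    asymmetric (fromMatrix M) u v
          | true | tri> _ _ _ | tri< _ _ _ with Vec.lookup (Vec.lookup M v) u
    ...     | true  = refl
    ...     | false = refl
    underlying (fromMatrix M) u v
      rewrite symmetric G v u with adj G u v in eq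
    ... | false = refl
    ... | true with <-cmp u v | <-cmp v u
    ...   | tri< u<v _ _  | tri< _ _ u≮v  = ⊥-elim (u≮v u<v)
    ...   | tri< _ u≢v _  | tri≈ _ v≡u _  = ⊥-elim (u≢v (sym v≡u))
    ...   | tri> _ u≢v _  | tri≈ _ v≡u _  = ⊥-elim (u≢v (sym v≡u))
    ...   | tri> _ _ v<u  | tri> v≮u _ _  = ⊥-elim (v≮u v<u)
    ...   | tri≈ _ refl _ | _ with () ← trans (sym eq) (irreflexive G u)
    underlying (fromMatrix M) u v
          | true | tri< _ _ _ | tri> _ _ _ with Vec.lookup (Vec.lookup M u) v
    ...     | true  = refl
    ...     | false = refl
    underlying (fromMatrix M) u v
          | true | tri> _ _ _ | tri< _ _ _ with Vec.lookup (Vec.lookup M v) u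
    ...     | true  = refl
    ...     | false = refl

    toMatrix : Orientation G → Vec (Subset n) n
    toMatrix o = tabulate λ u → tabulate (arc o u)

    lookup-toMatrix : ∀ o u v → Vec.lookup (Vec.lookup (toMatrix o) u) v ≡ arc o u v
    lookup-toMatrix o u v =
      trans (cong (λ row → Vec.lookup row v) (lookup∘tabulate (λ x → tabulate (arc o x)) u))
            (lookup∘tabulate (arc o u) v)

    fromMatrix-toMatrix : ∀ o → fromMatrix (toMatrix o) ≈ o
    fromMatrix-toMatrix o u v
      rewrite sym (underlying o u v) with <-cmp u v
    ... | tri≈ _ refl _ rewrite noLoop o u = refl
    ... | tri< _ _ _ rewrite lookup-toMatrix o u v with arc o u v | arc o v u
    ...   | true  | _     = refl
    ...   | false | true  = refl
    ...   | false | false = refl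
    fromMatrix-toMatrix o u v
        | tri> _ _ _ rewrite lookup-toMatrix o v u
          with arc o u v | arc o v u | asymmetric o u v
    ...   | true  | false | _ = refl
    ...   | false | true  | _ = refl
    ...   | false | false | _ = refl

    orientations : List (Orientation G)
    orientations = List.map fromMatrix (vecs (subsets n) n)

    representative : ∀ o → ∃ λ p → p ∈ orientations × p ≈ o
    representative o = fromMatrix (toMatrix o)
                     , ∈-map⁺ fromMatrix (∈-vecs ∈-subsets (toMatrix o))
                     , fromMatrix-toMatrix o

  invertAll-cong : ∀ {n k} {G : Graph n} (Xs : Vec (Subset n) k) {o p : Orientation G} →
                   o ≈ p → invertAll Xs o ≈ invertAll Xs p
  invertAll-cong []       o≈p = o≈p
  invertAll-cong (X ∷ Xs) o≈p = invertAll-cong Xs λ u v →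
    cong₂ (if bothIn X u v then_else_) (o≈p v u) (o≈p u v)

  transport : ∀ {n k} {G : Graph n} {o o′ p p′ : Orientation G} →
              o ≈ o′ → p ≈ p′ → TransformableIn k o p → TransformableIn k o′ p′
  transport o≈o′ p≈p′ (Xs , eq) = Xs , λ u v →
    trans (sym (invertAll-cong Xs o≈o′ u v)) (trans (eq u v) (p≈p′ u v))

abstract
  inversionDiameter-exists : ∀ {n} (G : Graph n) → ∃ (IsInversionDiameter G)
  inversionDiameter-exists {n} G =
    d* best , (proj₁ best , proj₂ best , proj₂ (inversionDistance-exists (proj₁ best) (proj₂ best))) , bound
    where
    d* : Orientation G × Orientation G → ℕ
    d* (o , p) = inversionDistance o p

    o₀ : Orientation G
    o₀ = fromMatrix G (Vec.replicate n (Vec.replicate n true))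

    pairs : List (Orientation G × Orientation G)
    pairs = cartesianProduct (orientations G) (orientations G)

    best : Orientation G × Orientation G
    best = argmax d* (o₀ , o₀) pairs

    bound : ∀ (o p : Orientation G) d → IsInversionDistance o p d → d ≤ d* best
    bound o p d (t , min) =
      let o′ , o′∈ , o′≈o = representative G o
          p′ , p′∈ , p′≈p = representative G p
          t′ , min′ = proj₂ (inversionDistance-exists o′ p′)
          d≡ = ≤-antisym (min _ (transport {o = o′} {o} {p′} {p} o′≈o p′≈p t′))
                         (min′ d (transport {o = o} {o′} {p} {p′} (λ u v → sym (o′≈o u v))
                                                                (λ u v → sym (p′≈p u v)) t))
      in subst (_≤ d* best) (sym d≡)
           (lookup (f[xs]≤f[argmax] {f = d*} (o₀ , o₀) pairs) (∈-cartesianProduct⁺ o′∈ p′∈))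

diam : ∀ {n} → Graph n → ℕ
diam G = proj₁ (inversionDiameter-exists G)

diam-isInversionDiameter : ∀ {n} (G : Graph n) → IsInversionDiameter G (diam G)
diam-isInversionDiameter G = proj₂ (inversionDiameter-exists G)

{-# OPTIONS --safe #-}

-- Writing x u ∈ 𝔽₂ᵏ for the indicator of the inversion sets containing u, an arc uv is
-- reversed by k inversions exactly when x u · x v = 1. So it suffices to realise every
-- symmetric w on the edges as x u · x v with k = Δ + ⌊log₂ Δ⌋. Correct the products at one
-- vertex v at a time, without changing them on the edges avoiding v. For u ∈ N(v) the
-- span of x on N(u) ∖ v has at most 2^(Δ-1) elements, and Δ · 2^(Δ-1) < 2ᵏ, so some a lies
-- in none of these spans. Set x v = a. For every u ∈ N(v) some y is orthogonal to x on
-- N(u) ∖ v while y · a = 1; adding y to x u where needed corrects the edge uv. As G is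
-- triangle-free, N(v) is independent, and these additions do not interfere.
module Submission where

open import Defs
open import Data.Bool.Base using (Bool; true; false; T; _∧_; _xor_; if_then_else_)
open import Data.Bool.Properties
  using (∧-comm; ∧-distribʳ-xor; xor-assoc; xor-same; xor-identityʳ; xor-∧-commutativeRing; T?)
  renaming (_≟_ to _≟ᵇ_)
open import Data.Fin.Base using (Fin; zero; suc)
open import Data.Fin.Properties using (_≟_)
open import Data.Fin.Subset using (Subset; ∣_∣)
open import Data.List.Base using (List; []; _∷_; _++_; map; concatMap; length; allFin)
open import Data.List.Extrema.Nat using (xs≤max)
open import Data.List.Membership.Propositional using (_∈_; _∉_; lose)
open import Data.List.Membership.Propositional.Properties
  using (∈-map⁺; ∈-++⁺ˡ; ∈-++⁺ʳ; ∈-allFin; ∈-concatMap⁺)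
open import Data.List.Properties using (length-map; length-++; length-removeAt)
open import Data.List.Relation.Unary.All as All using (All; []; _∷_)
open import Data.List.Relation.Unary.All.Properties
  using () renaming (map⁺ to All-map⁺; map⁻ to All-map⁻)
open import Data.List.Relation.Unary.Any using (here; there; index; _─_)
open import Data.Nat.Base using (ℕ; zero; suc; pred; _+_; _*_; _^_; _≤_; _<_; _≥_; z≤n; s≤s)
open import Data.Nat.Logarithm using (⌊log₂_⌋; ⌊log₂⌋-mono-≤; ⌊log₂[2^n]⌋≡n)
open import Data.Nat.Properties
  using ( ≤-trans; ≤-reflexive; +-mono-≤; *-monoˡ-≤; *-monoˡ-<; ^-monoʳ-≤; pred-mono-≤
        ; <⇒≱; ≮⇒≥; ≰⇒>; _<?_; 1+n≰n; +-suc; +-comm; ^-distribˡ-+-*; m^n≢0; module ≤-Reasoning)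
open import Data.Product.Base using (∃; _×_; _,_; proj₁; proj₂)
open import Data.Vec.Base as Vec using (Vec; []; _∷_; lookup; tabulate; replicate; zipWith)
open import Data.Vec.Properties using (lookup∘tabulate; tabulate∘lookup; tabulate-∘; tabulate-cong)
open import Function.Base using (_∘_)
open import Relation.Binary.PropositionalEquality
open import Relation.Nullary using (¬_; Dec; yes; no; contradiction)
open import Algebra.Bundles using (module CommutativeRing)
import Algebra.Properties.CommutativeSemigroup as CommutativeSemigroupProperties

private
  variable
    A B : Set
    k n : ℕ

-- Linear algebra over 𝔽₂

infixl 6 _⊕_
infix  7 _·_

_⊕_ : Vec Bool k → Vec Bool k → Vec Bool k
_⊕_ = zipWith _xor_

𝟎 : Vec Bool k
𝟎 = replicate _ false

_·_ : Vec Bool k → Vec Bool k → Bool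
[]      · []      = false
(a ∷ x) · (b ∷ y) = (a ∧ b) xor (x · y)

⊕-cancel : (z a : Vec Bool k) → z ⊕ (z ⊕ a) ≡ a
⊕-cancel []      []      = refl
⊕-cancel (c ∷ z) (b ∷ a) = cong₂ _∷_
  (trans (sym (xor-assoc c c b)) (cong (_xor b) (xor-same c))) (⊕-cancel z a)

·-comm : (x y : Vec Bool k) → x · y ≡ y · x
·-comm []      []      = refl
·-comm (a ∷ x) (b ∷ y) = cong₂ _xor_ (∧-comm a b) (·-comm x y)

·-zeroˡ : (x : Vec Bool k) → 𝟎 · x ≡ false
·-zeroˡ []      = refl
·-zeroˡ (_ ∷ x) = ·-zeroˡ x

·-distribʳ-⊕ : (z x y : Vec Bool k) → (x ⊕ y) · z ≡ (x · z) xor (y · z)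
·-distribʳ-⊕ []      []      []      = refl
·-distribʳ-⊕ (c ∷ z) (a ∷ x) (b ∷ y) = begin
  ((a xor b) ∧ c) xor ((x ⊕ y) · z)                  ≡⟨ cong₂ _xor_ (∧-distribʳ-xor c a b) (·-distribʳ-⊕ z x y) ⟩
  ((a ∧ c) xor (b ∧ c)) xor ((x · z) xor (y · z))    ≡⟨ interchange (a ∧ c) (b ∧ c) (x · z) (y · z) ⟩
  ((a ∧ c) xor (x · z)) xor ((b ∧ c) xor (y · z))    ∎
  where
  open ≡-Reasoning
  open CommutativeSemigroupProperties
    (CommutativeRing.+-commutativeSemigroup xor-∧-commutativeRing) using (interchange)

nonzero-pairing : (x : Vec Bool k) → x ≢ 𝟎 → ∃ λ y → y · x ≡ true
nonzero-pairing []          x≢𝟎 = contradiction refl x≢𝟎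
nonzero-pairing (true  ∷ x) x≢𝟎 = true ∷ 𝟎 , cong (true xor_) (·-zeroˡ x)
nonzero-pairing (false ∷ x) x≢𝟎 =
  let y , y·x = nonzero-pairing x (x≢𝟎 ∘ cong (false ∷_)) in false ∷ y , y·x

-- All subset sums, with repetitions kept: the length is then exactly a power of two, whether or not
-- the vectors are independent.
span : List (Vec Bool k) → List (Vec Bool k)
span []       = 𝟎 ∷ []
span (z ∷ zs) = span zs ++ map (z ⊕_) (span zs)

length-span : (zs : List (Vec Bool k)) → length (span zs) ≡ 2 ^ length zs
length-span []       = refl
length-span (z ∷ zs) = begin
  length (span zs ++ map (z ⊕_) (span zs))          ≡⟨ length-++ (span zs) ⟩
  length (span zs) + length (map (z ⊕_) (span zs))  ≡⟨ cong (length (span zs) +_) (length-map _ (span zs)) ⟩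
  length (span zs) + length (span zs)               ≡⟨ cong₂ _+_ (length-span zs) (length-span zs) ⟩
  2 ^ length zs + 2 ^ length zs                     ≡⟨ cong (2 ^ length zs +_) (+-comm 0 _) ⟩
  2 ^ length zs + (2 ^ length zs + 0)               ∎
  where open ≡-Reasoning

-- Induction on the list: neither `a` nor `z ⊕ a` lies in `span zs`, so each is separated from it,
-- by `y` and `y′`. One of `y`, `y′`, `y ⊕ y′` is also orthogonal to `z` and has product 1 with `a`.
∉span⇒separated : (zs : List (Vec Bool k)) {a : Vec Bool k} → a ∉ span zs →
                  ∃ λ y → y · a ≡ true × All (λ z → y · z ≡ false) zs
∉span⇒separated [] {a} a∉ =
  let y , y·a = nonzero-pairing a (a∉ ∘ here) in y , y·a , []
∉span⇒separated (z ∷ zs) {a} a∉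
  with y , y·a , y⊥zs ← ∉span⇒separated zs {a} (a∉ ∘ ∈-++⁺ˡ)
     | y′ , y′·[z⊕a] , y′⊥zs ← ∉span⇒separated zs {z ⊕ a}
         (a∉ ∘ ∈-++⁺ʳ (span zs) ∘ subst (_∈ map (z ⊕_) (span zs)) (⊕-cancel z a) ∘ ∈-map⁺ (z ⊕_))
  with y · z in y·z | y′ · z in y′·z
     | trans (sym (trans (·-comm y′ (z ⊕ a)) (·-distribʳ-⊕ y′ z a))) y′·[z⊕a]
... | false | _     | _ = y , y·a , y·z ∷ y⊥zs
... | true  | false | eq = y′ , y′·a , y′·z ∷ y′⊥zs
  where
  y′·a : y′ · a ≡ true
  y′·a rewrite ·-comm z y′ | y′·z | ·-comm a y′ = eq
-- Here `y′ · z` and `y′ · (z ⊕ a)` are both 1, which forces `y′ · a` to be 0. Hence the sum keeps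
-- product 1 with `a`, while the two products with `z` cancel.
... | true  | true  | eq =
  y ⊕ y′ , trans (·-distribʳ-⊕ a y y′) (cong₂ _xor_ y·a y′·a)
         , trans (·-distribʳ-⊕ z y y′) (cong₂ _xor_ y·z y′·z)
         ∷ All.zipWith (λ {t} (p , q) → trans (·-distribʳ-⊕ t y y′) (cong₂ _xor_ p q)) (y⊥zs , y′⊥zs)
  where
  y′·a : y′ · a ≡ false
  y′·a with y′ · a in eq′
  ... | false = refl
  ... | true rewrite ·-comm z y′ | y′·z | ·-comm a y′ | eq′ = sym eq

∉span⇒adjustable : (zs : List (Vec Bool k)) {a : Vec Bool k} → a ∉ span zs → ∀ x c →
                   ∃ λ x′ → x′ · a ≡ c × All (λ z → x′ · z ≡ x · z) zs
∉span⇒adjustable zs {a} a∉ x c with x · a ≟ᵇ c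
... | yes x·a≡c = x , x·a≡c , All.universal (λ _ → refl) zs
... | no  x·a≢c =
  let y , y·a , y⊥zs = ∉span⇒separated zs a∉ in
  x ⊕ y , trans (·-distribʳ-⊕ a x y) (flipped (x · a) c y·a x·a≢c)
        , All.map (λ {z} y·z → trans (·-distribʳ-⊕ z x y)
                                     (trans (cong (x · z xor_) y·z) (xor-identityʳ (x · z)))) y⊥zs
  where
  flipped : ∀ b c {d} → d ≡ true → b ≢ c → b xor d ≡ c
  flipped true  true  _    b≢c = contradiction refl b≢c
  flipped true  false refl _   = refl
  flipped false true  refl _   = refl
  flipped false false _    b≢c = contradiction refl b≢c

-- Counting

tailsOf : Bool → List (Vec Bool (suc k)) → List (Vec Bool k)
tailsOf b     []                  = []
tailsOf true  ((true  ∷ x) ∷ xs) = x ∷ tailsOf true xs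
tailsOf true  ((false ∷ x) ∷ xs) = tailsOf true xs
tailsOf false ((true  ∷ x) ∷ xs) = tailsOf false xs
tailsOf false ((false ∷ x) ∷ xs) = x ∷ tailsOf false xs

∈-tailsOf : ∀ b {x : Vec Bool k} {xs} → b ∷ x ∈ xs → x ∈ tailsOf b xs
∈-tailsOf true  (here refl) = here refl
∈-tailsOf false (here refl) = here refl
∈-tailsOf true  {xs = (true  ∷ _) ∷ _} (there x∈) = there (∈-tailsOf true x∈)
∈-tailsOf true  {xs = (false ∷ _) ∷ _} (there x∈) = ∈-tailsOf true x∈
∈-tailsOf false {xs = (true  ∷ _) ∷ _} (there x∈) = ∈-tailsOf false x∈
∈-tailsOf false {xs = (false ∷ _) ∷ _} (there x∈) = there (∈-tailsOf false x∈)

length-tailsOf : (xs : List (Vec Bool (suc k))) →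
                 length (tailsOf true xs) + length (tailsOf false xs) ≡ length xs
length-tailsOf []                  = refl
length-tailsOf ((true  ∷ _) ∷ xs) = cong suc (length-tailsOf xs)
length-tailsOf ((false ∷ _) ∷ xs) = trans (+-suc _ _) (cong suc (length-tailsOf xs))

-- Pigeonhole by bisection: split the list by first coordinate. The two halves cannot both have
-- `2 ^ k` entries or more, so the search continues in a shorter one.
missing : (xs : List (Vec Bool k)) → length xs < 2 ^ k → ∃ (_∉ xs)
missing {zero}  []       _ = [] , λ ()
missing {zero}  (_ ∷ _)  (s≤s ())
missing {suc k} xs       l with length (tailsOf true xs) <? 2 ^ k | length (tailsOf false xs) <? 2 ^ k
... | yes lt | _      = let x , x∉ = missing (tailsOf true xs) lt in true ∷ x , x∉ ∘ ∈-tailsOf true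
... | no  _  | yes lf = let x , x∉ = missing (tailsOf false xs) lf in false ∷ x , x∉ ∘ ∈-tailsOf false
... | no ≮t  | no ≮f  = contradiction full (<⇒≱ l)
  where
  full : 2 ^ suc k ≤ length xs
  full = begin
    2 ^ k + (2 ^ k + 0)                                   ≡⟨ cong (2 ^ k +_) (+-comm _ 0) ⟩
    2 ^ k + 2 ^ k                                         ≤⟨ +-mono-≤ (≮⇒≥ ≮t) (≮⇒≥ ≮f) ⟩
    length (tailsOf true xs) + length (tailsOf false xs)  ≡⟨ length-tailsOf xs ⟩
    length xs                                             ∎
    where open ≤-Reasoning

length-concatMap-≤ : ∀ (f : A → List B) {m} xs → All (λ x → length (f x) ≤ m) xs →
                     length (concatMap f xs) ≤ length xs * m
length-concatMap-≤ f []       []       = z≤n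
length-concatMap-≤ f (x ∷ xs) (p ∷ ps) =
  ≤-trans (≤-reflexive (length-++ (f x))) (+-mono-≤ p (length-concatMap-≤ f xs ps))

∈-─⁺ : {x y : A} {xs : List A} (x∈ : x ∈ xs) → y ∈ xs → y ≢ x → y ∈ (xs ─ x∈)
∈-─⁺ (here refl) (here refl) y≢x = contradiction refl y≢x
∈-─⁺ (here refl) (there y∈)  y≢x = y∈
∈-─⁺ (there x∈)  (here refl) y≢x = here refl
∈-─⁺ (there x∈)  (there y∈)  y≢x = there (∈-─⁺ x∈ y∈ y≢x)

elements : Subset n → List (Fin n)
elements []          = []
elements (true  ∷ p) = zero ∷ map suc (elements p)
elements (false ∷ p) = map suc (elements p)

length-elements : (p : Subset n) → length (elements p) ≡ ∣ p ∣
length-elements []          = refl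
length-elements (true  ∷ p) = cong suc (trans (length-map suc (elements p)) (length-elements p))
length-elements (false ∷ p) = trans (length-map suc (elements p)) (length-elements p)

∈-elements⁺ : (p : Subset n) {x : Fin n} → T (lookup p x) → x ∈ elements p
∈-elements⁺ (true  ∷ p) {zero}  _  = here refl
∈-elements⁺ (true  ∷ p) {suc x} px = there (∈-map⁺ suc (∈-elements⁺ p px))
∈-elements⁺ (false ∷ p) {suc x} px = ∈-map⁺ suc (∈-elements⁺ p px)

All-elements⁺ : ∀ {P : Fin n → Set} (p : Subset n) → (∀ x → T (lookup p x) → P x) → All P (elements p)
All-elements⁺ []          f = []
All-elements⁺ (true  ∷ p) f = f zero _ ∷ All-map⁺ (All-elements⁺ p (f ∘ suc))
All-elements⁺ (false ∷ p) f = All-map⁺ (All-elements⁺ p (f ∘ suc))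

-- An estimate with the binary logarithm

m<2^[1+⌊log₂m⌋] : ∀ m → m < 2 ^ suc ⌊log₂ m ⌋
m<2^[1+⌊log₂m⌋] m = ≰⇒> λ 2^≤m →
  1+n≰n (≤-trans (≤-reflexive (sym (⌊log₂[2^n]⌋≡n _))) (⌊log₂⌋-mono-≤ 2^≤m))

m*2^[m-1]<2^[m+⌊log₂m⌋] : ∀ m → m ≥ 1 → m * 2 ^ pred m < 2 ^ (m + ⌊log₂ m ⌋)
m*2^[m-1]<2^[m+⌊log₂m⌋] m@(suc d) _ = begin-strict
  -- The extra 1 in the exponent that bounds `m` is regained from `d`, which is one less than `m`.
  m * 2 ^ d                    <⟨ *-monoˡ-< (2 ^ d) {{m^n≢0 2 d}} (m<2^[1+⌊log₂m⌋] m) ⟩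
  2 ^ suc ⌊log₂ m ⌋ * 2 ^ d    ≡⟨ ^-distribˡ-+-* 2 (suc ⌊log₂ m ⌋) d ⟨
  2 ^ suc (⌊log₂ m ⌋ + d)      ≡⟨ cong (λ e → 2 ^ suc e) (+-comm ⌊log₂ m ⌋ d) ⟩
  2 ^ (m + ⌊log₂ m ⌋)          ∎
  where open ≤-Reasoning

-- Prescribing the products on the edges

module _ {n} (G : Graph n) where

  neighbourList : Fin n → List (Fin n)
  neighbourList v = elements (neighbours G v)

  ∈-neighbourList : ∀ {v u} → Adj G v u → u ∈ neighbourList v
  ∈-neighbourList {v} {u} vu =
    ∈-elements⁺ (neighbours G v) (subst T (sym (lookup∘tabulate (adj G v) u)) vu)

  All-neighbourList : ∀ {P : Fin n → Set} {v} → (∀ u → Adj G v u → P u) → All P (neighbourList v)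
  All-neighbourList {v = v} f =
    All-elements⁺ (neighbours G v) λ u → f u ∘ subst T (lookup∘tabulate (adj G v) u)

  length-neighbourList : ∀ v → length (neighbourList v) ≤ Δ G
  length-neighbourList v = ≤-trans (≤-reflexive (length-elements (neighbours G v)))
    (All.lookup (xs≤max 0 (map (degree G) (allFin n))) (∈-map⁺ (degree G) (∈-allFin v)))

  Adj-sym : ∀ {u v} → Adj G u v → Adj G v u
  Adj-sym {u} {v} = subst T (symmetric G u v)

  Adj-irrefl : ∀ {v} → ¬ Adj G v v
  Adj-irrefl {v} = subst T (irreflexive G v)

  -- Deleting the occurrence of `v` given by the adjacency proof shortens the list by exactly one.
  -- The default `[]` for non-adjacent vertices lets the bound `pred (Δ G)` hold for every pair.
  neighboursExcept : Fin n → Fin n → List (Fin n)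
  neighboursExcept v u with T? (adj G u v)
  ... | yes uv = neighbourList u ─ ∈-neighbourList uv
  ... | no  _  = []

  length-neighboursExcept : ∀ v u → length (neighboursExcept v u) ≤ pred (Δ G)
  length-neighboursExcept v u with T? (adj G u v)
  ... | yes uv = ≤-trans (≤-reflexive (length-removeAt (neighbourList u) (index (∈-neighbourList uv))))
                         (pred-mono-≤ (length-neighbourList u))
  ... | no  _  = z≤n

  ∈-neighboursExcept : ∀ {v u z} → Adj G u v → Adj G u z → z ≢ v → z ∈ neighboursExcept v u
  ∈-neighboursExcept {v} {u} uv uz z≢v with T? (adj G u v)
  ... | yes uv′ = ∈-─⁺ (∈-neighbourList uv′) (∈-neighbourList uz) z≢v
  ... | no ¬uv  = contradiction uv ¬uv

  module _ (triangleFree : TriangleFree G) (Δ≥1 : Δ G ≥ 1)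
           (w : Fin n → Fin n → Bool) (w-sym : ∀ u v → w u v ≡ w v u) where

    private
      dim : ℕ
      dim = Δ G + ⌊log₂ Δ G ⌋

    -- What the later arguments need to know about the new vector of `u`. In `neighbour` the
    -- preserved products are with the old `x z`: in a triangle-free graph such a `z` is not
    -- adjacent to `v`, so its vector stays the same.
    data Updated (x : Fin n → Vec Bool dim) (v : Fin n) (a : Vec Bool dim) (u : Fin n)
                 : Vec Bool dim → Set where
      pivot     : u ≡ v → Updated x v a u a
      neighbour : ∀ {b} → Adj G u v → b · a ≡ w u v →
                  (∀ z → Adj G u z → z ≢ v → b · x z ≡ x u · x z) → Updated x v a u b
      other     : u ≢ v → ¬ Adj G u v → Updated x v a u (x u)

    module _ (x : Fin n → Vec Bool dim) (v : Fin n) where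

      forbidden : Fin n → List (Vec Bool dim)
      forbidden u = span (map x (neighboursExcept v u))

      length-forbidden : ∀ u → length (forbidden u) ≤ 2 ^ pred (Δ G)
      length-forbidden u = begin
        length (forbidden u)                        ≡⟨ length-span (map x (neighboursExcept v u)) ⟩
        2 ^ length (map x (neighboursExcept v u))   ≡⟨ cong (2 ^_) (length-map x (neighboursExcept v u)) ⟩
        2 ^ length (neighboursExcept v u)           ≤⟨ ^-monoʳ-≤ 2 (length-neighboursExcept v u) ⟩
        2 ^ pred (Δ G)                              ∎
        where open ≤-Reasoning

      allForbidden : List (Vec Bool dim)
      allForbidden = concatMap forbidden (neighbourList v)

      length-allForbidden : length allForbidden < 2 ^ dim
      length-allForbidden = begin-strict
        length allForbidden
          ≤⟨ length-concatMap-≤ forbidden (neighbourList v) (All.universal length-forbidden _) ⟩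
        length (neighbourList v) * 2 ^ pred (Δ G)
          ≤⟨ *-monoˡ-≤ (2 ^ pred (Δ G)) (length-neighbourList v) ⟩
        Δ G * 2 ^ pred (Δ G)
          <⟨ m*2^[m-1]<2^[m+⌊log₂m⌋] (Δ G) Δ≥1 ⟩
        2 ^ dim
          ∎
        where open ≤-Reasoning

      update : ∀ {a} → a ∉ allForbidden → ∀ u → ∃ (Updated x v a u)
      update {a} a∉ u with u ≟ v | T? (adj G u v)
      ... | yes u≡v | _      = a , pivot u≡v
      ... | no u≢v  | no ¬uv = x u , other u≢v ¬uv
      ... | no _    | yes uv =
        let b , b·a , eqs = ∉span⇒adjustable (map x (neighboursExcept v u)) a∉u (x u) (w u v)
        in b , neighbour uv b·a λ z uz z≢v → All.lookup (All-map⁻ eqs) (∈-neighboursExcept uv uz z≢v)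
        where
        a∉u : a ∉ forbidden u
        a∉u a∈ = a∉ (∈-concatMap⁺ forbidden (lose (∈-neighbourList (Adj-sym uv)) a∈))

      updated-edge-pivot : ∀ {a u b c} → Updated x v a u b → Updated x v a v c →
                           Adj G u v → b · c ≡ w u v
      updated-edge-pivot (pivot refl)       _               uv = contradiction uv Adj-irrefl
      updated-edge-pivot (other _ ¬uv)      _               uv = contradiction uv ¬uv
      updated-edge-pivot (neighbour _ eq _) (pivot _)       uv = eq
      updated-edge-pivot (neighbour _ _ _)  (neighbour vv _ _) uv = contradiction vv Adj-irrefl
      updated-edge-pivot (neighbour _ _ _)  (other v≢v _)   uv = contradiction refl v≢v

      -- Two neighbours of `v` are never adjacent, so at most one end of the edge receives a new
      -- vector, and that vector was chosen to keep its product with the old vector at the other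
      -- end.
      updated-edge-avoiding : ∀ {a u z b c} → Updated x v a u b → Updated x v a z c →
                              u ≢ v → z ≢ v → Adj G u z → b · c ≡ x u · x z
      updated-edge-avoiding (pivot u≡v) _ u≢v _ _ = contradiction u≡v u≢v
      updated-edge-avoiding _ (pivot z≡v) _ z≢v _ = contradiction z≡v z≢v
      updated-edge-avoiding {u = u} {z} (neighbour uv _ _) (neighbour zv _ _) _ _ uz =
        contradiction (uv , Adj-sym zv , uz) (triangleFree u v z)
      updated-edge-avoiding {z = z} (neighbour _ _ eq) (other _ _) _ z≢v uz = eq z uz z≢v
      updated-edge-avoiding {u = u} {z} {c = c} (other _ _) (neighbour _ _ eq) u≢v _ uz =
        trans (·-comm (x u) c) (trans (eq u (Adj-sym uz) u≢v) (·-comm (x z) (x u)))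
      updated-edge-avoiding (other _ _) (other _ _) _ _ _ = refl

    -- Treating `v` corrects all edges at `v` and leaves the products on all other edges alone, so
    -- the edges at vertices treated earlier stay correct.
    prescribe-at : ∀ vs → ∃ λ (x : Fin n → Vec Bool dim) →
                   ∀ u v → v ∈ vs → Adj G u v → x u · x v ≡ w u v
    -- Any starting assignment would do, since nothing is claimed yet.
    prescribe-at []       = (λ _ → 𝟎) , λ _ _ ()
    prescribe-at (v ∷ vs) with x , correct ← prescribe-at vs
      with a , a∉ ← missing (allForbidden x v) (length-allForbidden x v) = x′ , correct′
      where
      x′ : Fin n → Vec Bool dim
      x′ u = proj₁ (update x v a∉ u)

      x′-updated : ∀ u → Updated x v a u (x′ u)
      x′-updated u = proj₂ (update x v a∉ u)

      correct-pivot : ∀ u → Adj G u v → x′ u · x′ v ≡ w u v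
      correct-pivot u = updated-edge-pivot x v (x′-updated u) (x′-updated v)

      correct′ : ∀ u z → z ∈ v ∷ vs → Adj G u z → x′ u · x′ z ≡ w u z
      correct′ u z z∈ uz = by-cases (z ≟ v) (u ≟ v) z∈
        where
        by-cases : Dec (z ≡ v) → Dec (u ≡ v) → z ∈ v ∷ vs → x′ u · x′ z ≡ w u z
        by-cases (yes refl) _          _           = correct-pivot u uz
        -- The edge is read from its other end, where `v` is second; this is where the symmetry of
        -- `w` enters.
        by-cases (no _)     (yes refl) _           =
          trans (·-comm (x′ v) (x′ z)) (trans (correct-pivot z (Adj-sym uz)) (w-sym z v))
        by-cases (no z≢v)   (no _)     (here z≡v)  = contradiction z≡v z≢v
        by-cases (no z≢v)   (no u≢v)   (there z∈vs) =
          trans (updated-edge-avoiding x v (x′-updated u) (x′-updated z) u≢v z≢v uz) (correct u z z∈vs uz)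

    prescribe : ∃ λ (x : Fin n → Vec Bool dim) → ∀ u v → Adj G u v → x u · x v ≡ w u v
    prescribe = let x , correct = prescribe-at (allFin n) in x , λ u v → correct u v (∈-allFin v)

-- Inversions as vectors

membership : Vec (Subset n) k → Fin n → Vec Bool k
membership Xs u = Vec.map (λ X → lookup X u) Xs

fromMembership : (Fin n → Vec Bool k) → Vec (Subset n) k
fromMembership x = tabulate λ i → tabulate λ u → lookup (x u) i

membership-fromMembership : (x : Fin n → Vec Bool k) → ∀ u → membership (fromMembership x) u ≡ x u
membership-fromMembership x u = begin
  membership (fromMembership x) u
    ≡⟨ tabulate-∘ (λ X → lookup X u) (λ i → tabulate λ v → lookup (x v) i) ⟨
  tabulate (λ i → lookup (tabulate λ v → lookup (x v) i) u)
    ≡⟨ tabulate-cong (λ i → lookup∘tabulate (λ v → lookup (x v) i) u) ⟩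
  tabulate (lookup (x u))
    ≡⟨ tabulate∘lookup (x u) ⟩
  x u
    ∎
  where open ≡-Reasoning

-- Only the parity of the number of sets containing both ends matters, and this parity is the
-- product of the membership vectors.
arc-invertAll : ∀ {G : Graph n} (Xs : Vec (Subset n) k) (o : Orientation G) u v →
                arc (invertAll Xs o) u v ≡
                (if membership Xs u · membership Xs v then arc o v u else arc o u v)
arc-invertAll []       o u v = refl
arc-invertAll (X ∷ Xs) o u v
  rewrite arc-invertAll Xs (invert X o) u v | ∧-comm (lookup X v) (lookup X u)
  with bothIn X u v | membership Xs u · membership Xs v
... | true  | true  = refl
... | true  | false = refl
... | false | true  = refl
... | false | false = refl

-- Disagreement of two orientations

differ : {G : Graph n} → Orientation G → Orientation G → Fin n → Fin n → Bool
differ o p u v = arc o u v xor arc p u v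

-- On an edge, each orientation has exactly one of the two arcs, so a disagreement shows in both
-- directions; elsewhere there are no arcs.
differ-sym : ∀ {G : Graph n} (o p : Orientation G) u v → differ o p u v ≡ differ o p v u
differ-sym o p u v
  with arc o u v | arc o v u | arc p u v | arc p v u
     | asymmetric o u v | asymmetric p u v | trans (underlying o u v) (sym (underlying p u v))
... | true  | false | true  | false | _ | _ | _ = refl
... | true  | false | false | true  | _ | _ | _ = refl
... | false | true  | true  | false | _ | _ | _ = refl
... | false | true  | false | true  | _ | _ | _ = refl
... | false | false | false | false | _ | _ | _ = refl

flip-differing : ∀ {G : Graph n} (o p : Orientation G) u v b → (Adj G u v → b ≡ differ o p u v) →
                 (if b then arc o v u else arc o u v) ≡ arc p u v
flip-differing {G = G} o p u v b b≡
  with adj G u v | arc o u v | arc o v u | arc p u v | arc p v u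
     | asymmetric o u v | asymmetric p u v | underlying o u v | underlying p u v
-- Off the edges `b` is unconstrained, but there is no arc to reverse.
... | false | false | false | false | false | _ | _ | _ | _ with b
...   | true  = refl
...   | false = refl
flip-differing o p u v b b≡ | true | true  | false | true  | false | _ | _ | _ | _ rewrite b≡ _ = refl
flip-differing o p u v b b≡ | true | true  | false | false | true  | _ | _ | _ | _ rewrite b≡ _ = refl
flip-differing o p u v b b≡ | true | false | true  | true  | false | _ | _ | _ | _ rewrite b≡ _ = refl
flip-differing o p u v b b≡ | true | false | true  | false | true  | _ | _ | _ | _ rewrite b≡ _ = refl

transformable : (G : Graph n) → TriangleFree G → Δ G ≥ 1 →
                (o p : Orientation G) → TransformableIn (Δ G + ⌊log₂ Δ G ⌋) o p
transformable G triangleFree Δ≥1 o p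
  with x , x·x ← prescribe G triangleFree Δ≥1 (differ o p) (differ-sym o p) =
  fromMembership x , λ u v → begin
    arc (invertAll (fromMembership x) o) u v
      ≡⟨ arc-invertAll (fromMembership x) o u v ⟩
    (if membership (fromMembership x) u · membership (fromMembership x) v then arc o v u else arc o u v)
      ≡⟨ cong (if_then arc o v u else arc o u v)
           (cong₂ _·_ (membership-fromMembership x u) (membership-fromMembership x v)) ⟩
    (if x u · x v then arc o v u else arc o u v)
      ≡⟨ flip-differing o p u v (x u · x v) (x·x u v) ⟩
    arc p u v
      ∎
  where open ≡-Reasoning

theorem1p4 : (n : ℕ) (G : Graph n) → TriangleFree G → Δ G ≥ 1 → diam G ≤ Δ G + ⌊log₂ Δ G ⌋
theorem1p4 n G triangleFree Δ≥1 =
  -- The diameter is the distance of some pair `o`, `p`, so it is at most any number of inversions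
  -- that transforms `o` into `p`.
  let o , p , _ , least = proj₁ (diam-isInversionDiameter G)
  in least (Δ G + ⌊log₂ Δ G ⌋) (transformable G triangleFree Δ≥1 o p)
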